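{- Let $C$ be a conjecture in ZFC (seen as a sub-theory of NBG) given by a well-formed formula $\phi$. Then there exists a corresponding dual conjecture $C^+$ in D-ZFC, given by the dual well-formed formula $\phi^+$, such that $C$ is provable in ZFC if and only if $C^+$ is provable in D-ZFC, i.e., $\mathrm{ZFC}\vdash\phi$ if and only if $\text{D-ZFC}\vdash\phi^+$. Moreover, if $P=(P_1,\dots,P_m)$ is a proof of $\phi$ in ZFC, then its dual version $P^+=(P_1^+,\dots,P_m^+)$ is a proof of $\phi^+$ in D-ZFC, and vice versa. In other words, standard mathematics (the theories grounded on ZFC) and dathematics (the dual theories grounded on D-ZFC) are meta-isomorphic. In particular, ZFC and D-ZFC are equiconsistent.
   Context: NBG is von Neumann–Bernays–Gödel set theory (in Mendelson's presentation), a first-order theory of classes with equality and membership $\in$; a class $X$ is a set if $(\exists Y)(X\in Y)$. ZFC is seen as a sub-theory of NBG by letting its variables range over sets. For every class $X$, $X^+$ denotes its complement class, the unique class such that for all sets $a$: $a\in X\leftrightarrow a\notin X^+$. The dual membership relation $\varepsilon$ between classes is defined by $$(\forall A,B)(A\,\varepsilon\,B\leftrightarrow A^+\in B^+).$$ A class $X$ is a sed (dual set) if $(\exists Y)(X\,\varepsilon\,Y)$; equivalently, if its complement $X^+$ is a set. Equality is self-dual: $(\forall Z)(Z\,\varepsilon\,X\leftrightarrow Z\,\varepsilon\,Y)$ holds if and only if $X=Y$. For a formula $\phi$ in the language $\{=,\in\}$ of ZFC (all variables ranging over sets), $\phi^+$ is the formula in the language $\{=,\varepsilon\}$ obtained by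 replacing every occurrence of $\in$ by $\varepsilon$ and every set variable by a sed variable of the same name (a variable ranging over seds). Such a formula is called a dual well-formed formula. D-ZFC is the first-order theory in the language $\{=,\varepsilon\}$, with variables ranging over seds, whose proper axioms are the duals $\psi^+$ of the axioms $\psi$ of ZFC, with the usual logical axioms of first-order logic with equality and the same inference rules as ZFC (Modus Ponens and Generalization). It is regarded as a sub-theory of NBG by interpreting $A\,\varepsilon\,B$ as $A^+\in B^+$ and letting its variables range over the seds, i.e., the classes $X$ whose complement $X^+$ is a set. "Meta-isomorphic" means the syntactic correspondence described in the claim: $\phi\mapsto\phi^+$ and $P\mapsto P^+$ match formulas, theorems and proofs of ZFC with those of D-ZFC, in both directions. -}

module Defs where

open import Data.Fin.Base as Fin using (Fin)
open import Data.List.Base using (List; []; _∷_; _++_; filter; foldr)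
import Data.List.Membership.Propositional as List
open import Data.Nat.Base using (ℕ; suc; _⊔_)
import Data.Nat.Properties as ℕ
open import Data.Product.Base using (_×_; ∃)
open import Data.Vec.Base using (Vec; lookup; last; map)
open import Function.Bundles using (_⇔_)
open import Function.Definitions using (Bijective)
open import Relation.Binary.Definitions using (DecidableEquality)
open import Relation.Binary.PropositionalEquality using (_≡_; _≢_; cong)
open import Relation.Nullary.Decidable using (map′; ¬?; yes; no)
open import Relation.Nullary.Negation using (¬_)

------------------------------------------------------------------------
-- First-order languages with equality and one binary predicate symbol

-- The intended range of the variables: all classes (NBG), sets (ZFC) or
-- seds (D-ZFC).  Each range comes with its own variables and symbol.
data Range : Set where
  classes sets seds : Range

record Var (k : Range) : Set where
  constructor var
  field name : ℕ

open Var public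

data Symbol : Range → Set where
  ∈-class : Symbol classes
  ∈-set   : Symbol sets
  ε-sed   : Symbol seds

infix  9 _[_≔_]
infix  8 _≐_ _⟨_⟩_ _∈_ _∈ᶜ_ _ε_
infixr 7 ~_
infixr 6 _∧_
infixr 5 _∨_
infixr 4 _⇒_
infix  3 _⟺_
infixr 7 ∀[_]_ ∃[_]_

data Formula (k : Range) : Set where
  _≐_   : Var k → Var k → Formula k
  _⟨_⟩_ : Var k → Symbol k → Var k → Formula k
  ~_    : Formula k → Formula k
  _⇒_   : Formula k → Formula k → Formula k
  ∀[_]_ : Var k → Formula k → Formula k

private variable k l : Range

_∧_ _∨_ _⟺_ : Formula k → Formula k → Formula k
φ ∧ ψ = ~ (φ ⇒ ~ ψ)
φ ∨ ψ = ~ φ ⇒ ψ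
φ ⟺ ψ = (φ ⇒ ψ) ∧ (ψ ⇒ φ)

∃[_]_ : Var k → Formula k → Formula k
∃[ x ] φ = ~ ∀[ x ] ~ φ

_≟_ : DecidableEquality (Var k)
x ≟ y = map′ (cong var) (cong name) (name x ℕ.≟ name y)

freeVars : Formula k → List (Var k)
freeVars (x ≐ y)      = x ∷ y ∷ []
freeVars (x ⟨ _ ⟩ y)  = x ∷ y ∷ []
freeVars (~ φ)        = freeVars φ
freeVars (φ ⇒ ψ)      = freeVars φ ++ freeVars ψ
freeVars (∀[ x ] φ)   = filter (λ y → ¬? (y ≟ x)) (freeVars φ)

Free : Var k → Formula k → Set
Free x φ = x List.∈ freeVars φ

substVar : (x t : Var k) → Var k → Var k
substVar x t y with y ≟ x
... | yes _ = t
... | no  _ = y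

-- Not capture-avoiding: meaningful only under FreeFor t x φ.
_[_≔_] : Formula k → Var k → Var k → Formula k
(y ≐ z)     [ x ≔ t ] = substVar x t y ≐ substVar x t z
(y ⟨ s ⟩ z) [ x ≔ t ] = substVar x t y ⟨ s ⟩ substVar x t z
(~ φ)       [ x ≔ t ] = ~ (φ [ x ≔ t ])
(φ ⇒ ψ)     [ x ≔ t ] = φ [ x ≔ t ] ⇒ ψ [ x ≔ t ]
(∀[ y ] φ)  [ x ≔ t ] with y ≟ x
... | yes _ = ∀[ y ] φ
... | no  _ = ∀[ y ] (φ [ x ≔ t ])

-- No free occurrence of x in the formula lies in the scope of ∀[ t ].
data FreeFor (t x : Var k) : Formula k → Set where
  eq      : ∀ {y z} → FreeFor t x (y ≐ z)
  rel     : ∀ {y s z} → FreeFor t x (y ⟨ s ⟩ z)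
  neg     : ∀ {φ} → FreeFor t x φ → FreeFor t x (~ φ)
  imp     : ∀ {φ ψ} → FreeFor t x φ → FreeFor t x ψ → FreeFor t x (φ ⇒ ψ)
  notFree : ∀ {y φ} → ¬ Free x (∀[ y ] φ) → FreeFor t x (∀[ y ] φ)
  under   : ∀ {y φ} → y ≢ t → FreeFor t x φ → FreeFor t x (∀[ y ] φ)

data ReplaceVar (x y : Var k) : Var k → Var k → Set where
  keep    : ∀ {z} → ReplaceVar x y z z
  replace : ReplaceVar x y x y

-- Replace x y φ ψ: ψ arises from φ by replacing some, not necessarily
-- all, free occurrences of x by y.
data Replace (x y : Var k) : Formula k → Formula k → Set where
  eq    : ∀ {u u′ v v′} → ReplaceVar x y u u′ → ReplaceVar x y v v′ →
          Replace x y (u ≐ v) (u′ ≐ v′)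
  rel   : ∀ {u u′ s v v′} → ReplaceVar x y u u′ → ReplaceVar x y v v′ →
          Replace x y (u ⟨ s ⟩ v) (u′ ⟨ s ⟩ v′)
  neg   : ∀ {φ φ′} → Replace x y φ φ′ → Replace x y (~ φ) (~ φ′)
  imp   : ∀ {φ φ′ ψ ψ′} → Replace x y φ φ′ → Replace x y ψ ψ′ →
          Replace x y (φ ⇒ ψ) (φ′ ⇒ ψ′)
  bound : ∀ {φ} → Replace x y (∀[ x ] φ) (∀[ x ] φ)
  under : ∀ {z φ φ′} → z ≢ x → Replace x y φ φ′ →
          Replace x y (∀[ z ] φ) (∀[ z ] φ′)

------------------------------------------------------------------------
-- Theories and proofs

-- Mendelson's logical axioms (A1)–(A5) and equality axioms (A6), (A7).
data LogicalAxiom {k : Range} : Formula k → Set where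
  A1 : ∀ φ ψ → LogicalAxiom (φ ⇒ (ψ ⇒ φ))
  A2 : ∀ φ ψ χ →
       LogicalAxiom ((φ ⇒ (ψ ⇒ χ)) ⇒ ((φ ⇒ ψ) ⇒ (φ ⇒ χ)))
  A3 : ∀ φ ψ → LogicalAxiom ((~ ψ ⇒ ~ φ) ⇒ ((~ ψ ⇒ φ) ⇒ ψ))
  A4 : ∀ x t φ → FreeFor t x φ → LogicalAxiom (∀[ x ] φ ⇒ φ [ x ≔ t ])
  A5 : ∀ x φ ψ → ¬ Free x φ →
       LogicalAxiom (∀[ x ] (φ ⇒ ψ) ⇒ (φ ⇒ ∀[ x ] ψ))
  A6 : ∀ x → LogicalAxiom (∀[ x ] (x ≐ x))
  A7 : ∀ x y φ ψ → FreeFor y x φ → Replace x y φ ψ →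
       LogicalAxiom (x ≐ y ⇒ (φ ⇒ ψ))

-- A theory is given by its proper axioms.
Theory : Range → Set₁
Theory k = Formula k → Set

data Justified {m} (T : Theory k) (P : Vec (Formula k) m) (i : Fin m) : Set where
  logical : LogicalAxiom (lookup P i) → Justified T P i
  proper  : T (lookup P i) → Justified T P i
  mp      : ∀ j j′ → j Fin.< i → j′ Fin.< i →
            lookup P j′ ≡ (lookup P j ⇒ lookup P i) → Justified T P i
  gen     : ∀ j x → j Fin.< i →
            lookup P i ≡ ∀[ x ] (lookup P j) → Justified T P i

IsProof : ∀ {n} → Theory k → Vec (Formula k) (suc n) → Formula k → Set
IsProof T P φ = (∀ i → Justified T P i) × last P ≡ φ

infix 2 _⊢_

_⊢_ : Theory k → Formula k → Set
T ⊢ φ = ∃ λ n → ∃ λ (P : Vec _ (suc n)) → IsProof T P φ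

Consistent : Theory k → Set
Consistent T = ¬ (∃ λ φ → (T ⊢ φ) × (T ⊢ ~ φ))

------------------------------------------------------------------------
-- ZFC

_∈_ : Var sets → Var sets → Formula sets
x ∈ y = x ⟨ ∈-set ⟩ y

private
  x₀ x₁ x₂ x₃ x₄ : Var sets
  x₀ = var 0
  x₁ = var 1
  x₂ = var 2
  x₃ = var 3
  x₄ = var 4

data ZFC : Formula sets → Set where
  extensionality : ZFC (
    ∀[ x₀ ] ∀[ x₁ ] (∀[ x₂ ] (x₂ ∈ x₀ ⟺ x₂ ∈ x₁) ⇒ x₀ ≐ x₁))
  foundation : ZFC (
    ∀[ x₀ ] (∃[ x₁ ] x₁ ∈ x₀ ⇒
             ∃[ x₁ ] (x₁ ∈ x₀ ∧ ~ ∃[ x₂ ] (x₂ ∈ x₁ ∧ x₂ ∈ x₀))))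
  pairing : ZFC (
    ∀[ x₀ ] ∀[ x₁ ] ∃[ x₂ ] ∀[ x₃ ] (x₃ ∈ x₂ ⟺ x₃ ≐ x₀ ∨ x₃ ≐ x₁))
  union : ZFC (
    ∀[ x₀ ] ∃[ x₁ ] ∀[ x₂ ] (x₂ ∈ x₁ ⟺ ∃[ x₃ ] (x₂ ∈ x₃ ∧ x₃ ∈ x₀)))
  powerSet : ZFC (
    ∀[ x₀ ] ∃[ x₁ ] ∀[ x₂ ] (x₂ ∈ x₁ ⟺ ∀[ x₃ ] (x₃ ∈ x₂ ⇒ x₃ ∈ x₀)))
  infinity : ZFC (
    ∃[ x₀ ] (∃[ x₁ ] (x₁ ∈ x₀ ∧ ∀[ x₂ ] ~ x₂ ∈ x₁) ∧
             ∀[ x₁ ] (x₁ ∈ x₀ ⇒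
               ∃[ x₂ ] (x₂ ∈ x₀ ∧
                        ∀[ x₃ ] (x₃ ∈ x₂ ⟺ x₃ ∈ x₁ ∨ x₃ ≐ x₁)))))
  -- Every family of nonempty, pairwise disjoint sets has a transversal.
  choice : ZFC (
    ∀[ x₀ ] (∀[ x₁ ] (x₁ ∈ x₀ ⇒ ∃[ x₂ ] x₂ ∈ x₁) ∧
             ∀[ x₁ ] ∀[ x₂ ] (x₁ ∈ x₀ ∧ x₂ ∈ x₀ ∧ ~ x₁ ≐ x₂ ⇒
                              ~ ∃[ x₃ ] (x₃ ∈ x₁ ∧ x₃ ∈ x₂)) ⇒
             ∃[ x₁ ] ∀[ x₂ ] (x₂ ∈ x₀ ⇒
               ∃[ x₃ ] ∀[ x₄ ] (x₄ ∈ x₂ ∧ x₄ ∈ x₁ ⟺ x₄ ≐ x₃))))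
  -- In both schemas φ may contain further free variables (parameters).
  separation : ∀ φ {a b x} → a ≢ b → x ≢ a → x ≢ b → ¬ Free b φ → ZFC (
    ∀[ a ] ∃[ b ] ∀[ x ] (x ∈ b ⟺ x ∈ a ∧ φ))
  -- φ is required to be functional (y determined by x) on a only;
  -- ∃[ w ] ∀[ y ] (φ ⇒ y ≐ w) says that at most one y satisfies φ.
  replacement : ∀ φ {a b w x y} →
    a ≢ b → x ≢ a → x ≢ b → y ≢ a → y ≢ b → x ≢ y → w ≢ x → w ≢ y →
    ¬ Free b φ → ¬ Free w φ → ZFC (
    ∀[ a ] (∀[ x ] (x ∈ a ⇒ ∃[ w ] ∀[ y ] (φ ⇒ y ≐ w)) ⇒
            ∃[ b ] ∀[ y ] (y ∈ b ⟺ ∃[ x ] (x ∈ a ∧ φ))))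

------------------------------------------------------------------------
-- Duality

infix 10 _⁺

_⁺ : Formula sets → Formula seds
(var m ≐ var n) ⁺           = var m ≐ var n
(var m ⟨ ∈-set ⟩ var n) ⁺   = var m ⟨ ε-sed ⟩ var n
(~ φ) ⁺                     = ~ φ ⁺
(φ ⇒ ψ) ⁺                   = φ ⁺ ⇒ ψ ⁺
(∀[ var n ] φ) ⁺            = ∀[ var n ] φ ⁺

data D-ZFC : Formula seds → Set where
  dual : ∀ {ψ} → ZFC ψ → D-ZFC (ψ ⁺)

------------------------------------------------------------------------
-- Reading formulas about sets or seds as formulas of NBG

_∈ᶜ_ : Var classes → Var classes → Formula classes
X ∈ᶜ Y = X ⟨ ∈-class ⟩ Y

fresh : Var classes → Var classes → Var classes
fresh X Y = var (suc (name X ⊔ name Y))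

IsSet : Var classes → Formula classes
IsSet X = ∃[ Y ] X ∈ᶜ Y
  where Y = fresh X X

-- X′ is the complement class of X.
IsComplement : Var classes → Var classes → Formula classes
IsComplement X′ X = ∀[ a ] (IsSet a ⇒ (a ∈ᶜ X ⟺ ~ a ∈ᶜ X′))
  where a = fresh X X′

-- NBG has no complement term, so the complements are introduced by
-- quantifiers.
_ε_ : Var classes → Var classes → Formula classes
A ε B = ∃[ A′ ] ∃[ B′ ] (IsComplement A′ A ∧ IsComplement B′ B ∧ A′ ∈ᶜ B′)
  where
  A′ = fresh A B
  B′ = fresh A A′

IsSed : Var classes → Formula classes
IsSed X = ∃[ Y ] X ε Y
  where Y = fresh X X

inRange : Range → Var classes → Formula classes
inRange classes X = X ≐ X
inRange sets    X = IsSet X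
inRange seds    X = IsSed X

asClass : Var k → Var classes
asClass (var n) = var n

relativise : Formula k → Formula classes
relativise (x ≐ y)             = asClass x ≐ asClass y
relativise (x ⟨ ∈-class ⟩ y)   = asClass x ∈ᶜ asClass y
relativise (x ⟨ ∈-set ⟩ y)     = asClass x ∈ᶜ asClass y
relativise (x ⟨ ε-sed ⟩ y)     = asClass x ε asClass y
relativise (~ φ)               = ~ relativise φ
relativise (φ ⇒ ψ)             = relativise φ ⇒ relativise ψ
relativise {k} (∀[ x ] φ)      =
  ∀[ asClass x ] (inRange k (asClass x) ⇒ relativise φ)

-- Free variables are restricted to the intended range as well.
inNBG : Formula k → Formula classes
inNBG {k} φ =
  foldr (λ x ψ → inRange k (asClass x) ⇒ ψ) (relativise φ) (freeVars φ)

-- The class-theoretic assertion C is the one expressed by φ.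
_IsGivenBy_ : Formula classes → Formula k → Set
C IsGivenBy φ = C ≡ inNBG φ

------------------------------------------------------------------------
-- Meta-isomorphism

record MetaIsomorphic (T : Theory k) (T′ : Theory l)
                      (f : Formula k → Formula l) : Set where
  field
    formulas  : Bijective _≡_ _≡_ f
    sequences : ∀ n → Bijective _≡_ _≡_ (map {n = n} f)
    theorems  : ∀ φ → (T ⊢ φ) ⇔ (T′ ⊢ f φ)
    proofs    : ∀ {n} (P : Vec (Formula k) (suc n)) φ →
                IsProof T P φ ⇔ IsProof T′ (map f P) (f φ)

Equiconsistent : Theory k → Theory l → Set
Equiconsistent T T′ = Consistent T ⇔ Consistent T′

{-# OPTIONS --safe #-}

-- Duality merely relabels the membership symbol and the variables.  Every
-- relabelling of symbols carries logical axioms and inference steps along, and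
-- the one that carries ∈ to ε has a two-sided inverse.  Hence the converse
-- implications need no analysis of D-ZFC proofs: they are instances of the
-- same preservation theorem, for the inverse relabelling.
module Submission where

open import Defs
open import Data.Bool.Base using (true; false)
open import Data.List.Base as List using (List; []; _∷_; filter)
import Data.List.Membership.Propositional as List
open import Data.List.Membership.Propositional.Properties using (∈-map⁻)
open import Data.List.Properties using (map-++)
open import Data.Nat.Base using (ℕ; suc)
open import Data.Product.Base using (_×_; _,_; ∃)
open import Data.Vec.Base using (Vec; []; _∷_; lookup; last; map)
open import Data.Vec.Properties using (lookup-map; map-cong; map-∘; map-id)
open import Function.Base using (_∘_)
open import Function.Bundles using (_⇔_; mk⇔)
open import Function.Consequences.Propositional
  using (inverseᵇ⇒bijective; strictlyInverseˡ⇒inverseˡ; strictlyInverseʳ⇒inverseʳ)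
open import Function.Definitions using (Bijective)
open import Relation.Binary.PropositionalEquality
  using (_≡_; _≢_; refl; sym; trans; cong; cong₂; subst; subst₂; _≗_; module ≡-Reasoning)
open import Relation.Nullary.Decidable using (Dec; yes; no; does; ¬?)
open import Relation.Nullary.Negation using (¬_; contradiction)
open import Relation.Unary using (Decidable)

private variable
  k l : Range
  n   : ℕ

-- Relabelling of variables and formulas

relabelVar : Var k → Var l
relabelVar (var m) = var m

relabelVar-injective : {x y : Var k} → relabelVar {l = l} x ≡ relabelVar y → x ≡ y
relabelVar-injective refl = refl

relabel : (Symbol k → Symbol l) → Formula k → Formula l
relabel σ (x ≐ y)     = relabelVar x ≐ relabelVar y
relabel σ (x ⟨ s ⟩ y) = relabelVar x ⟨ σ s ⟩ relabelVar y
relabel σ (~ φ)       = ~ relabel σ φ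
relabel σ (φ ⇒ ψ)     = relabel σ φ ⇒ relabel σ ψ
relabel σ (∀[ x ] φ)  = ∀[ relabelVar x ] relabel σ φ

-- On variables the round trip is the identity by eta for `Var`, so everything rests on the symbols.
relabel-inverse : {σ : Symbol k → Symbol l} {τ : Symbol l → Symbol k} →
                  (∀ s → τ (σ s) ≡ s) → ∀ φ → relabel τ (relabel σ φ) ≡ φ
relabel-inverse τσ (x ≐ y)     = refl
relabel-inverse τσ (x ⟨ s ⟩ y) = cong (λ s → x ⟨ s ⟩ y) (τσ s)
relabel-inverse τσ (~ φ)       = cong ~_ (relabel-inverse τσ φ)
relabel-inverse τσ (φ ⇒ ψ)     = cong₂ _⇒_ (relabel-inverse τσ φ) (relabel-inverse τσ ψ)
relabel-inverse τσ (∀[ x ] φ)  = cong (∀[ x ]_) (relabel-inverse τσ φ)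

-- Comparing truth values through `does` avoids translating proofs of `P` into proofs of `Q`.
filter-map : ∀ {A B : Set} {P : A → Set} {Q : B → Set}
             (P? : Decidable P) (Q? : Decidable Q) (f : A → B) →
             (∀ x → does (Q? (f x)) ≡ does (P? x)) →
             ∀ xs → filter Q? (List.map f xs) ≡ List.map f (filter P? xs)
filter-map P? Q? f Q≡P [] = refl
filter-map P? Q? f Q≡P (x ∷ xs) rewrite Q≡P x with does (P? x)
... | true  = cong (f x ∷_) (filter-map P? Q? f Q≡P xs)
... | false = filter-map P? Q? f Q≡P xs

relabelVar-≢ : {x y : Var k} → x ≢ y → relabelVar {l = l} x ≢ relabelVar y
relabelVar-≢ x≢y = x≢y ∘ relabelVar-injective

-- Here and in the next three lemmas the outcomes of `y ≟ x` become equations, so that later case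
-- splits can use them instead of abstracting the test.
substVar-≡ : {x t y : Var k} → y ≡ x → substVar x t y ≡ t
substVar-≡ {x = x} {y = y} y≡x with y ≟ x
... | yes _  = refl
... | no y≢x = contradiction y≡x y≢x

substVar-≢ : {x t y : Var k} → y ≢ x → substVar x t y ≡ y
substVar-≢ {x = x} {y = y} y≢x with y ≟ x
... | yes y≡x = contradiction y≡x y≢x
... | no _    = refl

∀-[≔]-≡ : ∀ {x t y : Var k} {φ} → y ≡ x → (∀[ y ] φ) [ x ≔ t ] ≡ ∀[ y ] φ
∀-[≔]-≡ {x = x} {y = y} y≡x with y ≟ x
... | yes _  = refl
... | no y≢x = contradiction y≡x y≢x

∀-[≔]-≢ : ∀ {x t y : Var k} {φ} → y ≢ x → (∀[ y ] φ) [ x ≔ t ] ≡ ∀[ y ] φ [ x ≔ t ]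
∀-[≔]-≢ {x = x} {y = y} y≢x with y ≟ x
... | yes y≡x = contradiction y≡x y≢x
... | no _    = refl

-- The decision is passed as an argument because the terms deciding y ≡ x before
-- and after relabelling normalise alike, which makes a with-abstraction ill-typed.
substVar-relabelVar : (x t y : Var k) →
  substVar (relabelVar {l = l} x) (relabelVar t) (relabelVar y) ≡
  relabelVar (substVar x t y)
substVar-relabelVar {l = l} x t y = by-cases (y ≟ x)
  where
  by-cases : Dec (y ≡ x) →
    substVar (relabelVar {l = l} x) (relabelVar t) (relabelVar y) ≡
    relabelVar (substVar x t y)
  by-cases (yes y≡x) =
    trans (substVar-≡ (cong relabelVar y≡x)) (cong relabelVar (sym (substVar-≡ y≡x)))
  by-cases (no y≢x) =
    trans (substVar-≢ (relabelVar-≢ y≢x)) (cong relabelVar (sym (substVar-≢ y≢x)))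

ReplaceVar-relabelVar : ∀ {x y u v : Var k} → ReplaceVar x y u v →
  ReplaceVar (relabelVar {l = l} x) (relabelVar y) (relabelVar u) (relabelVar v)
ReplaceVar-relabelVar keep    = keep
ReplaceVar-relabelVar replace = replace

-- Preservation of side conditions and logical axioms

module _ (σ : Symbol k → Symbol l) where

  freeVars-relabel : ∀ φ → freeVars (relabel σ φ) ≡ List.map relabelVar (freeVars φ)
  freeVars-relabel (x ≐ y)     = refl
  freeVars-relabel (x ⟨ s ⟩ y) = refl
  freeVars-relabel (~ φ)       = freeVars-relabel φ
  freeVars-relabel (φ ⇒ ψ)
    rewrite freeVars-relabel φ | freeVars-relabel ψ =
    sym (map-++ relabelVar (freeVars φ) (freeVars ψ))
  freeVars-relabel (∀[ x ] φ)  =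
    trans (cong (filter λ y → ¬? (y ≟ relabelVar x)) (freeVars-relabel φ))
          -- `_≟_` compares only names, which `relabelVar` keeps, so both tests compute to the same
          -- truth value.
          (filter-map (λ y → ¬? (y ≟ x)) _ relabelVar (λ _ → refl) (freeVars φ))

  -- Negated freeness needs freeness to be reflected: a free variable of the relabelled formula is
  -- the image of a free variable of `φ`, which injectivity identifies with `x`.
  ¬Free-relabel : ∀ {x} φ → ¬ Free x φ → ¬ Free (relabelVar x) (relabel σ φ)
  ¬Free-relabel φ x∉φ x∈φ′ =
    let y , y∈φ , x≡y = ∈-map⁻ relabelVar (subst (_ List.∈_) (freeVars-relabel φ) x∈φ′)
    in x∉φ (subst (List._∈ freeVars φ) (sym (relabelVar-injective x≡y)) y∈φ)

  -- Substitution only tests variables for equality, which relabelling preserves and reflects.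
  relabel-[≔] : ∀ φ x t →
    relabel σ φ [ relabelVar x ≔ relabelVar t ] ≡ relabel σ (φ [ x ≔ t ])
  relabel-[≔] (y ≐ z)     x t =
    cong₂ _≐_ (substVar-relabelVar x t y) (substVar-relabelVar x t z)
  relabel-[≔] (y ⟨ s ⟩ z) x t =
    cong₂ (_⟨ σ s ⟩_) (substVar-relabelVar x t y) (substVar-relabelVar x t z)
  relabel-[≔] (~ φ)       x t = cong ~_ (relabel-[≔] φ x t)
  relabel-[≔] (φ ⇒ ψ)     x t = cong₂ _⇒_ (relabel-[≔] φ x t) (relabel-[≔] ψ x t)
  relabel-[≔] (∀[ y ] φ)  x t = by-cases (y ≟ x)
    where
    by-cases : Dec (y ≡ x) →
      relabel σ (∀[ y ] φ) [ relabelVar x ≔ relabelVar t ] ≡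
      relabel σ ((∀[ y ] φ) [ x ≔ t ])
    by-cases (yes y≡x) =
      trans (∀-[≔]-≡ (cong relabelVar y≡x)) (cong (relabel σ) (sym (∀-[≔]-≡ y≡x)))
    by-cases (no y≢x) = begin
      relabel σ (∀[ y ] φ) [ relabelVar x ≔ relabelVar t ]
        ≡⟨ ∀-[≔]-≢ (relabelVar-≢ y≢x) ⟩
      ∀[ relabelVar y ] relabel σ φ [ relabelVar x ≔ relabelVar t ]
        ≡⟨ cong (∀[ relabelVar y ]_) (relabel-[≔] φ x t) ⟩
      relabel σ (∀[ y ] φ [ x ≔ t ])
        ≡⟨ cong (relabel σ) (∀-[≔]-≢ y≢x) ⟨
      relabel σ ((∀[ y ] φ) [ x ≔ t ]) ∎
      where open ≡-Reasoning

  FreeFor-relabel : ∀ {t x φ} → FreeFor t x φ →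
                    FreeFor (relabelVar t) (relabelVar x) (relabel σ φ)
  FreeFor-relabel eq                    = eq
  FreeFor-relabel rel                   = rel
  FreeFor-relabel (neg f)               = neg (FreeFor-relabel f)
  FreeFor-relabel (imp f g)             = imp (FreeFor-relabel f) (FreeFor-relabel g)
  FreeFor-relabel (notFree {y} {φ} x∉φ) = notFree (¬Free-relabel (∀[ y ] φ) x∉φ)
  FreeFor-relabel (under y≢t f)         = under (relabelVar-≢ y≢t) (FreeFor-relabel f)

  Replace-relabel : ∀ {x y φ ψ} → Replace x y φ ψ →
    Replace (relabelVar x) (relabelVar y) (relabel σ φ) (relabel σ ψ)
  Replace-relabel (eq r s)      = eq (ReplaceVar-relabelVar r) (ReplaceVar-relabelVar s)
  Replace-relabel (rel r s)     = rel (ReplaceVar-relabelVar r) (ReplaceVar-relabelVar s)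
  Replace-relabel (neg r)       = neg (Replace-relabel r)
  Replace-relabel (imp r s)     = imp (Replace-relabel r) (Replace-relabel s)
  Replace-relabel bound         = bound
  Replace-relabel (under z≢x r) = under (relabelVar-≢ z≢x) (Replace-relabel r)

  LogicalAxiom-relabel : ∀ {φ} → LogicalAxiom φ → LogicalAxiom (relabel σ φ)
  LogicalAxiom-relabel (A1 φ ψ)   = A1 _ _
  LogicalAxiom-relabel (A2 φ ψ χ) = A2 _ _ _
  LogicalAxiom-relabel (A3 φ ψ)   = A3 _ _
  LogicalAxiom-relabel (A4 x t φ f) =
    -- `A4` yields substitution into the relabelled formula, while the goal relabels the substituted
    -- one.
    subst (λ ψ → LogicalAxiom (relabel σ (∀[ x ] φ) ⇒ ψ)) (relabel-[≔] φ x t)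
      (A4 _ _ _ (FreeFor-relabel f))
  LogicalAxiom-relabel (A5 x φ ψ x∉φ) = A5 _ _ _ (¬Free-relabel φ x∉φ)
  LogicalAxiom-relabel (A6 x)         = A6 _
  LogicalAxiom-relabel (A7 x y φ ψ f r) =
    A7 _ _ _ _ (FreeFor-relabel f) (Replace-relabel r)

-- Preservation of proofs

last-map : ∀ {A B : Set} (f : A → B) (xs : Vec A (suc n)) → last (map f xs) ≡ f (last xs)
last-map f (x ∷ [])     = refl
last-map f (x ∷ y ∷ xs) = last-map f (y ∷ xs)

module _ {T : Theory k} {T′ : Theory l} (σ : Symbol k → Symbol l)
         (T⇒T′ : ∀ {φ} → T φ → T′ (relabel σ φ)) where

  -- Premises keep their positions, so the order conditions carry over as they are; `lookup-map`
  -- turns each entry into the relabelled original.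
  Justified-relabel : ∀ {P : Vec (Formula k) n} {i} →
                      Justified T P i → Justified T′ (map (relabel σ) P) i
  Justified-relabel {P = P} {i} (logical a) =
    logical (subst LogicalAxiom (sym (lookup-map i (relabel σ) P)) (LogicalAxiom-relabel σ a))
  Justified-relabel {P = P} {i} (proper a) =
    proper (subst T′ (sym (lookup-map i (relabel σ) P)) (T⇒T′ a))
  Justified-relabel {P = P} {i} (mp j j′ j<i j′<i e) = mp j j′ j<i j′<i (begin
    lookup (map (relabel σ) P) j′
      ≡⟨ lookup-map j′ (relabel σ) P ⟩
    relabel σ (lookup P j′)
      ≡⟨ cong (relabel σ) e ⟩
    (relabel σ (lookup P j) ⇒ relabel σ (lookup P i))
      ≡⟨ cong₂ _⇒_ (lookup-map j (relabel σ) P) (lookup-map i (relabel σ) P) ⟨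
    (lookup (map (relabel σ) P) j ⇒ lookup (map (relabel σ) P) i) ∎)
    where open ≡-Reasoning
  Justified-relabel {P = P} {i} (gen j x j<i e) = gen j (relabelVar x) j<i (begin
    lookup (map (relabel σ) P) i
      ≡⟨ lookup-map i (relabel σ) P ⟩
    relabel σ (lookup P i)
      ≡⟨ cong (relabel σ) e ⟩
    ∀[ relabelVar x ] relabel σ (lookup P j)
      ≡⟨ cong (∀[ relabelVar x ]_) (lookup-map j (relabel σ) P) ⟨
    ∀[ relabelVar x ] lookup (map (relabel σ) P) j ∎)
    where open ≡-Reasoning

  IsProof-relabel : ∀ {P : Vec (Formula k) (suc n)} {φ} →
                    IsProof T P φ → IsProof T′ (map (relabel σ) P) (relabel σ φ)
  IsProof-relabel {P = P} (justified , refl) =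
    (λ i → Justified-relabel (justified i)) , last-map (relabel σ) P

-- Duality as an invertible relabelling

inverse⇒bijective : ∀ {A B : Set} {f : A → B} {g : B → A} →
                    g ∘ f ≗ (λ x → x) → f ∘ g ≗ (λ y → y) → Bijective _≡_ _≡_ f
inverse⇒bijective {f = f} gf fg =
  inverseᵇ⇒bijective (strictlyInverseˡ⇒inverseˡ f fg , strictlyInverseʳ⇒inverseʳ f gf)

map-inverse : ∀ {A B : Set} {f : A → B} {g : B → A} →
              g ∘ f ≗ (λ x → x) → ∀ (xs : Vec A n) → map g (map f xs) ≡ xs
map-inverse {f = f} {g} gf xs =
  trans (sym (map-∘ g f xs)) (trans (map-cong gf xs) (map-id xs))

∈⇒ε : Symbol sets → Symbol seds
∈⇒ε ∈-set = ε-sed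

ε⇒∈ : Symbol seds → Symbol sets
ε⇒∈ ε-sed = ∈-set

infix 10 _⁻

-- Defined as a relabelling outright, so that `IsProof-relabel` applies to it without transport.
_⁻ : Formula seds → Formula sets
_⁻ = relabel ε⇒∈

-- `_⁺` has its own recursion, so the agreement takes an induction; in the membership case the
-- symbol is matched to let both sides reduce.
relabel≗⁺ : relabel ∈⇒ε ≗ _⁺
relabel≗⁺ (x ≐ y)         = refl
relabel≗⁺ (x ⟨ ∈-set ⟩ y) = refl
relabel≗⁺ (~ φ)           = cong ~_ (relabel≗⁺ φ)
relabel≗⁺ (φ ⇒ ψ)         = cong₂ _⇒_ (relabel≗⁺ φ) (relabel≗⁺ ψ)
relabel≗⁺ (∀[ x ] φ)      = cong (∀[ relabelVar x ]_) (relabel≗⁺ φ)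

⁺⁻-inverse : ∀ φ → (φ ⁺) ⁻ ≡ φ
⁺⁻-inverse φ = trans (cong _⁻ (sym (relabel≗⁺ φ))) (relabel-inverse (λ { ∈-set → refl }) φ)

⁻⁺-inverse : ∀ φ → (φ ⁻) ⁺ ≡ φ
⁻⁺-inverse φ = trans (sym (relabel≗⁺ (φ ⁻))) (relabel-inverse (λ { ε-sed → refl }) φ)

IsProof-⁺ : ∀ {P : Vec (Formula sets) (suc n)} {φ} →
            IsProof ZFC P φ → IsProof D-ZFC (map _⁺ P) (φ ⁺)
IsProof-⁺ {P = P} {φ} p =
  -- `IsProof-relabel` speaks of `relabel ∈⇒ε`; the pointwise agreement translates axioms, sequence
  -- and conclusion between it and `_⁺`.
  subst₂ (IsProof D-ZFC) (map-cong relabel≗⁺ P) (relabel≗⁺ φ)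
    (IsProof-relabel ∈⇒ε (λ {ψ} a → subst D-ZFC (sym (relabel≗⁺ ψ)) (dual a)) p)

-- An axiom of `D-ZFC` is by definition the dual of an axiom of `ZFC`, which `_⁻` recovers; this
-- covers the schemas uniformly.
D-ZFC⇒ZFC : ∀ {φ} → D-ZFC φ → ZFC (φ ⁻)
D-ZFC⇒ZFC (dual {ψ} a) = subst ZFC (sym (⁺⁻-inverse ψ)) a

IsProof-⁻ : ∀ {P : Vec (Formula seds) (suc n)} {φ} →
            IsProof D-ZFC P φ → IsProof ZFC (map _⁻ P) (φ ⁻)
IsProof-⁻ = IsProof-relabel ε⇒∈ D-ZFC⇒ZFC

proofs⇔ : (P : Vec (Formula sets) (suc n)) (φ : Formula sets) →
          IsProof ZFC P φ ⇔ IsProof D-ZFC (map _⁺ P) (φ ⁺)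
proofs⇔ P φ = mk⇔ IsProof-⁺
  -- `_⁻` turns the dual proof into `map _⁻ (map _⁺ P)`, which the inverse law identifies with `P`.
  (subst₂ (IsProof ZFC) (map-inverse ⁺⁻-inverse P) (⁺⁻-inverse φ) ∘ IsProof-⁻)

⊢-⁻ : ∀ {φ} → D-ZFC ⊢ φ → ZFC ⊢ φ ⁻
⊢-⁻ (n , P , p) = n , map _⁻ P , IsProof-⁻ p

⊢-⁺ : ∀ {φ} → ZFC ⊢ φ → D-ZFC ⊢ φ ⁺
⊢-⁺ (n , P , p) = n , map _⁺ P , IsProof-⁺ p

theorems⇔ : (φ : Formula sets) → (ZFC ⊢ φ) ⇔ (D-ZFC ⊢ φ ⁺)
theorems⇔ φ = mk⇔ ⊢-⁺ (subst (ZFC ⊢_) (⁺⁻-inverse φ) ∘ ⊢-⁻)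

theorem3p1 : ((C : Formula classes) (φ : Formula sets) → C IsGivenBy φ →
    ∃ λ (C⁺ : Formula classes) → ∃ λ (φ⁺ : Formula seds) →
    φ⁺ ≡ φ ⁺
    × C⁺ IsGivenBy φ⁺
    × ((ZFC ⊢ φ) ⇔ (D-ZFC ⊢ φ⁺))
    × (∀ (n : ℕ) (P : Vec (Formula sets) (suc n)) →
    IsProof ZFC P φ ⇔ IsProof D-ZFC (map _⁺ P) φ⁺))
    × MetaIsomorphic ZFC D-ZFC _⁺
    × Equiconsistent ZFC D-ZFC
theorem3p1 =
    -- The dual conjecture is the NBG reading of `φ ⁺`: variables restricted to seds, `ε` unfolded
    -- through complements.
    (λ C φ _ → inNBG (φ ⁺) , φ ⁺ , refl , refl , theorems⇔ φ , λ n P → proofs⇔ P φ)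
  , record
      { formulas  = inverse⇒bijective ⁺⁻-inverse ⁻⁺-inverse
      ; sequences = λ n → inverse⇒bijective (map-inverse ⁺⁻-inverse) (map-inverse ⁻⁺-inverse)
      ; theorems  = theorems⇔
      ; proofs    = proofs⇔
      }
  -- A contradiction in one theory is carried to the other; `_⁻` and `_⁺` commute with `~_` by
  -- computation, so the pair stays contradictory.
  , mk⇔ (λ con (φ , p , q) → con (φ ⁻ , ⊢-⁻ p , ⊢-⁻ q))
        (λ con (φ , p , q) → con (φ ⁺ , ⊢-⁺ p , ⊢-⁺ q))
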